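{- Let $M\ge \frac52$ and $\mu=\frac{2}{2M+3}$. Algorithm A (defined in the context) is a valid semi-online algorithm with migration factor at most $M$, and for every input whose optimal offline makespan is $1$ it produces a schedule of makespan at most $1+\mu=\frac{2M+5}{2M+3}$. Hence its competitive ratio is at most $\frac{2M+5}{2M+3}$.
   Context: Model (two hierarchical machines with migration, bin stretching). Jobs $1,2,\dots,n$ arrive one by one ($n$ unknown in advance). Job $j$ has a size $p_j>0$ and a grade of service (GoS) $g_j\in\{1,2\}$; a job of GoS $1$ may only be processed on machine $m_1$, a job of GoS $2$ may be processed on $m_1$ or on $m_2$. The load of a machine is the total size of the jobs assigned to it, and the makespan is the maximum load. When job $j$ arrives, the algorithm must assign it to a machine, and at the same time it may reassign (migrate) previously arrived jobs to other machines (respecting the GoS constraints), provided that the total size of the migrated jobs is at most $M\cdot p_j$; $M\ge 0$ is the migration factor. Bin stretching: the optimal offline makespan of the complete input is known in advance and scaled to $1$; in particular every job has size at most $1$, the total size of all jobs is at most $2$, and the total size of all GoS-$1$ jobs is at most $1$. The competitive ratio of an algorithm is the supremum over inputs of (algorithm's makespan)/(optimal makespan). Notation: $Y_{j}$ is the set of jobs on $m_2$ just after job $j$ has been handled (including migrations), $y_j$ its total size, $y_0=0$. $Z$ denotes the set of GoS-2 jobs currently on $m_1$. Algorithm A (with $\mu=\frac{2}{2M+3}$). On arrival of job $j$: (i) if $g_j=1$ or $y_{j-1}\ge 1-\mu$, assign $j$ to $m_1$; (ii) else if $y_{j-1}+p_j\le 1+\mu$, assign $j$ to $m_2$; (iii)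 otherwise, among all GoS-2 jobs arrived so far (the current $Z$, the current $Y_{j-1}$, and $j$), choose a subset $W$ of maximum total size subject to total size at most $1$; rearrange so that exactly the jobs of $W$ are on $m_2$ and all other arrived jobs are on $m_1$. -}

module Defs where

open import Level using (Level; suc; _⊔_)
open import Data.Nat.Base as ℕ using (ℕ)
open import Data.Bool.Base using (not; if_then_else_)
open import Data.Fin.Base using (Fin)
open import Data.Fin.Subset using (Subset; _⊆_; inside; outside)
open import Data.Product.Base using (_×_; _,_; ∃)
open import Data.Sum.Base using (_⊎_)
open import Data.Vec.Base using (Vec; []; _∷_; _++_; map; tail; zipWith; lookup)
open import Algebra.Bundles using (CommutativeRing)
import Algebra.Construct.NaturalChoice.Max as Max
open import Algebra.Core using (Op₁; Op₂)
open import Algebra.Structures using (IsCommutativeRing)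
open import Relation.Binary.Bundles using (DecTotalOrder)
open import Relation.Binary.Core using (Rel)
open import Relation.Binary.Definitions using (DecidableEquality)
open import Relation.Binary.PropositionalEquality using (_≡_; refl)
import Relation.Binary.Construct.NonStrictToStrict as NonStrictToStrict
open import Relation.Binary.Structures using (IsDecTotalOrder)
open import Relation.Nullary.Decidable using (yes; no; does)
open import Relation.Nullary.Negation using (¬_)
open import Relation.Unary using (Pred)

-- Sizes and the migration factor range over an arbitrary linearly ordered
-- field; classically ℝ is one.  The order is decidable because the algorithm
-- branches on comparisons.
record OrderedField c ℓ₁ ℓ₂ : Set (suc (c ⊔ ℓ₁ ⊔ ℓ₂)) where
  infix  8 -_
  infix  9 _⁻¹
  infixl 7 _*_ _/_
  infixl 6 _+_ _-_
  infix  4 _≈_ _≤_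
  field
    Carrier           : Set c
    _≈_               : Rel Carrier ℓ₁
    _≤_               : Rel Carrier ℓ₂
    _+_ _*_           : Op₂ Carrier
    -_ _⁻¹            : Op₁ Carrier
    0# 1#             : Carrier
    isCommutativeRing : IsCommutativeRing _≈_ _+_ _*_ -_ 0# 1#
    isDecTotalOrder   : IsDecTotalOrder _≈_ _≤_
    0≉1               : ¬ (0# ≈ 1#)
    -- The value of 0# ⁻¹ is unspecified.
    ⁻¹-cong           : ∀ {x y} → x ≈ y → x ⁻¹ ≈ y ⁻¹
    ⁻¹-inverseʳ       : ∀ x → ¬ (x ≈ 0#) → x * x ⁻¹ ≈ 1#
    +-monoʳ-≤         : ∀ x {y z} → y ≤ z → x + y ≤ x + z
    *-nonNegative     : ∀ {x y} → 0# ≤ x → 0# ≤ y → 0# ≤ x * y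

  commutativeRing : CommutativeRing c ℓ₁
  commutativeRing = record { isCommutativeRing = isCommutativeRing }

  decTotalOrder : DecTotalOrder c ℓ₁ ℓ₂
  decTotalOrder = record { isDecTotalOrder = isDecTotalOrder }

  open NonStrictToStrict _≈_ _≤_ public using (_<_)

  open Max (DecTotalOrder.totalOrder decTotalOrder) public
    using () renaming (_⊔_ to max)

  _-_ _/_ : Op₂ Carrier
  x - y = x + (- y)
  x / y = x * y ⁻¹

  2# 3# 5# : Carrier
  2# = 1# + 1#
  3# = 2# + 1#
  5# = 3# + 2#

data GoS : Set where
  gos₁ gos₂ : GoS

data Machine : Set where
  m₁ m₂ : Machine

_≟ᴳ_ : DecidableEquality GoS
gos₁ ≟ᴳ gos₁ = yes refl
gos₁ ≟ᴳ gos₂ = no λ ()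
gos₂ ≟ᴳ gos₁ = no λ ()
gos₂ ≟ᴳ gos₂ = yes refl

_≟ᴹ_ : DecidableEquality Machine
m₁ ≟ᴹ m₁ = yes refl
m₁ ≟ᴹ m₂ = no λ ()
m₂ ≟ᴹ m₁ = no λ ()
m₂ ≟ᴹ m₂ = yes refl

private
  variable
    m n : ℕ

Schedule : ℕ → Set
Schedule = Vec Machine

jobsOn : Machine → Schedule n → Subset n
jobsOn k = map (λ k′ → does (k′ ≟ᴹ k))

exactlyOn₂ : Subset n → Schedule n
exactlyOn₂ = map (λ b → if b then m₂ else m₁)

-- The earlier jobs whose machine changes when a new job (the head) arrives;
-- placing the new job itself is not a migration.
migrated : Schedule n → Schedule (ℕ.suc n) → Subset n
migrated σ τ = zipWith (λ k k′ → not (does (k ≟ᴹ k′))) σ (tail τ)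

module BinStretching {c ℓ₁ ℓ₂} (F : OrderedField c ℓ₁ ℓ₂) where
  open OrderedField F

  record Job : Set (c ⊔ ℓ₁ ⊔ ℓ₂) where
    field
      size     : Carrier
      size-pos : 0# < size
      gos      : GoS
  open Job public

  -- Job sequences are listed latest job first: in  j ∷ js  the job j arrives
  -- after all of js, and in  later ++ js  the jobs js are the first to arrive.
  Jobs : ℕ → Set (c ⊔ ℓ₁ ⊔ ℓ₂)
  Jobs = Vec Job

  total : Jobs n → Subset n → Carrier
  total []       []            = 0#
  total (j ∷ js) (inside  ∷ S) = size j + total js S
  total (j ∷ js) (outside ∷ S) = total js S

  load : Machine → Jobs n → Schedule n → Carrier
  load k js σ = total js (jobsOn k σ)

  makespan : Jobs n → Schedule n → Carrier
  makespan js σ = max (load m₁ js σ) (load m₂ js σ)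

  Admissible : Jobs n → Schedule n → Set
  Admissible js σ = ∀ i → gos (lookup js i) ≡ gos₁ → lookup σ i ≡ m₁

  IsOptimalMakespan : Jobs n → Carrier → Set (ℓ₁ ⊔ ℓ₂)
  IsOptimalMakespan js o =
    (∃ λ σ → Admissible js σ × makespan js σ ≈ o) ×
    (∀ σ → Admissible js σ → o ≤ makespan js σ)

  -- The schedule of all jobs arrived so far, as a function of these jobs only.
  SemiOnlineAlgorithm : Set (c ⊔ ℓ₁ ⊔ ℓ₂)
  SemiOnlineAlgorithm = ∀ {n} → Jobs n → Schedule n

  RespectsGoS : SemiOnlineAlgorithm → Set (c ⊔ ℓ₁ ⊔ ℓ₂)
  RespectsGoS alg = ∀ {n} (js : Jobs n) → Admissible js (alg js)

  -- The optimum 1 is that of the complete input, the migration bound holds at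
  -- every arrival during that input.
  MigrationFactorAtMost : Carrier → SemiOnlineAlgorithm → Set (c ⊔ ℓ₁ ⊔ ℓ₂)
  MigrationFactorAtMost M alg =
    ∀ {m n} (later : Jobs m) (j : Job) (js : Jobs n) →
    IsOptimalMakespan (later ++ j ∷ js) 1# →
    total js (migrated (alg js) (alg (j ∷ js))) ≤ M * size j

  Ratio : SemiOnlineAlgorithm → Pred Carrier (c ⊔ ℓ₁ ⊔ ℓ₂)
  Ratio alg x = ∃ λ n → ∃ λ (js : Jobs n) →
    IsOptimalMakespan js 1# × x ≈ makespan js (alg js) / 1#

  IsSupremum : ∀ {ℓ} → Pred Carrier ℓ → Carrier → Set (c ⊔ ℓ₂ ⊔ ℓ)
  IsSupremum P s =
    (∀ x → P x → x ≤ s) × (∀ b → (∀ x → P x → x ≤ b) → s ≤ b)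

  IsCompetitiveRatio : SemiOnlineAlgorithm → Carrier → Set (c ⊔ ℓ₁ ⊔ ℓ₂)
  IsCompetitiveRatio alg = IsSupremum (Ratio alg)

  gos₂Jobs : Jobs n → Subset n
  gos₂Jobs = map (λ j → does (gos j ≟ᴳ gos₂))

  IsMaximumSubset : Jobs n → Subset n → Set ℓ₂
  IsMaximumSubset js W =
    W ⊆ gos₂Jobs js × total js W ≤ 1# ×
    (∀ V → V ⊆ gos₂Jobs js → total js V ≤ 1# → total js V ≤ total js W)

  module AlgorithmA (M : Carrier) where

    μ : Carrier
    μ = 2# / (2# * M + 3#)

    -- Step j js σ τ: when j arrives after js, which are scheduled by σ, the
    -- algorithm may respond with τ.  Only the choice among several maximum W
    -- in rule-iii is left open.
    data Step (j : Job) (js : Jobs n) (σ : Schedule n) :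
              Schedule (ℕ.suc n) → Set (c ⊔ ℓ₁ ⊔ ℓ₂) where
      rule-i   : gos j ≡ gos₁ ⊎ 1# - μ ≤ load m₂ js σ →
              Step j js σ (m₁ ∷ σ)
      rule-ii  : gos j ≡ gos₂ → load m₂ js σ < 1# - μ →
              load m₂ js σ + size j ≤ 1# + μ →
              Step j js σ (m₂ ∷ σ)
      rule-iii : gos j ≡ gos₂ → load m₂ js σ < 1# - μ →
              1# + μ < load m₂ js σ + size j →
              (W : Subset (ℕ.suc n)) → IsMaximumSubset (j ∷ js) W →
              Step j js σ (exactlyOn₂ W)

    IsAlgorithmA : SemiOnlineAlgorithm → Set (c ⊔ ℓ₁ ⊔ ℓ₂)
    IsAlgorithmA alg =
      ∀ {n} (j : Job) (js : Jobs n) → Step j js (alg js) (alg (j ∷ js))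

{-# OPTIONS --safe #-}

-- As long as m₂ carries less than 1 - μ, its load y dominates every set of
-- GoS-2 jobs of total size at most 1: rule (ii) adds the same job to both
-- sides, and rule (iii) chooses a maximum.  Both bounds then come from comparing
-- with an offline schedule of makespan at most 1.
--
-- Makespan: if y ≥ 1 - μ, then m₁ carries at most 2 - y.  Otherwise the offline
-- load of m₂ is at most y, so m₁ carries at most the offline load of m₁.
--
-- Migration in rule (iii): the job j has size p > 2μ.  Offline, the machine of j
-- carries at most 1, and the GoS-2 jobs on the other one at most y.  So the
-- earlier GoS-2 jobs have total size at most 1 + y - p < 2 - 3μ = 2Mμ < Mp.
module Submission where

open import Defs
open import Level using (Level; _⊔_)
open import Algebra.Bundles using (CommutativeRing)
import Algebra.Construct.NaturalChoice.Max as Max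
import Algebra.Properties.Ring as RingProperties
import Algebra.Solver.Ring.NaturalCoefficients.Default as RingSolver
open import Data.Bool.Base using (if_then_else_; not)
open import Data.Empty using (⊥-elim)
open import Data.Fin.Base using (zero; suc)
open import Data.Fin.Subset using (Subset; _⊆_; _∩_; ⊤; ⊥; inside; outside)
open import Data.Fin.Subset.Properties using (_⊆?_; ⊆-min; drop-∷-⊆; p∩q⊆p; p∩q⊆q; ∩-identityˡ)
open import Data.Nat.Base as ℕ using (ℕ)
open import Data.Product.Base using (_×_; _,_; ∃; proj₁; proj₂)
open import Data.Sum.Base using (_⊎_; inj₁; inj₂)
open import Data.Vec.Base using ([]; _∷_; _++_; here; lookup)
open import Data.Vec.Properties using (lookup-map; lookup-zipWith; []=⇒lookup; lookup⇒[]=)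
open import Function.Base using (_∘_)
open import Relation.Binary.Bundles using (DecTotalOrder)
import Relation.Binary.Properties.DecTotalOrder as DecTotalOrderProperties
import Relation.Binary.Reasoning.PartialOrder as PartialOrderReasoning
open import Relation.Binary.PropositionalEquality as ≡ using (_≡_; refl; cong; cong₂)
open import Relation.Nullary.Decidable using (yes; no; does; _×-dec_)
open import Relation.Nullary.Negation using (¬_; contradiction)
open import Relation.Unary using (Decidable)

private
  variable
    n : ℕ

-- Arithmetic of linearly ordered fields.

module OrderedFieldProperties {c ℓ₁ ℓ₂} (F : OrderedField c ℓ₁ ℓ₂) where
  open OrderedField F
  open CommutativeRing commutativeRing public
    using (+-congˡ; +-congʳ; +-comm; +-assoc; +-identityˡ; +-identityʳ;
           *-congˡ; *-congʳ; *-identityˡ; *-identityʳ; distribˡ; distribʳ; -‿cong;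
           -‿inverseˡ; -‿inverseʳ; ring; commutativeSemiring)
  open RingProperties ring using (-‿distribʳ-*; -‿involutive)
  open DecTotalOrder decTotalOrder public
    using (_≤?_; total; poset; module Eq)
    renaming (refl to ≤-refl; reflexive to ≤-reflexive; trans to ≤-trans; antisym to ≤-antisym)
  open DecTotalOrderProperties decTotalOrder public using (<⇒≱; ≰⇒>)
  open Max (DecTotalOrder.totalOrder decTotalOrder) public using (x≤x⊔y; x≤y⊔x; ⊔-lub)
  open PartialOrderReasoning poset public
  open RingSolver commutativeSemiring public using (solve; _:=_; _:+_; _:*_; con)

  +-monoˡ-≤ : ∀ z {x y} → x ≤ y → x + z ≤ y + z
  +-monoˡ-≤ z {x} {y} x≤y = begin
    x + z  ≈⟨ +-comm x z ⟩
    z + x  ≤⟨ +-monoʳ-≤ z x≤y ⟩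
    z + y  ≈⟨ +-comm z y ⟩
    y + z  ∎

  +-mono-≤ : ∀ {x y u v} → x ≤ y → u ≤ v → x + u ≤ y + v
  +-mono-≤ {y = y} {u} x≤y u≤v = ≤-trans (+-monoˡ-≤ u x≤y) (+-monoʳ-≤ y u≤v)

  [x+y]-y≈x : ∀ x y → (x + y) - y ≈ x
  [x+y]-y≈x x y = begin-equality
    (x + y) - y    ≈⟨ +-assoc x y (- y) ⟩
    x + (y - y)    ≈⟨ +-congˡ (-‿inverseʳ y) ⟩
    x + 0#         ≈⟨ +-identityʳ x ⟩
    x              ∎

  [x-y]+y≈x : ∀ x y → (x - y) + y ≈ x
  [x-y]+y≈x x y = begin-equality
    (x - y) + y      ≈⟨ +-assoc x (- y) y ⟩
    x + (- y + y)    ≈⟨ +-congˡ (-‿inverseˡ y) ⟩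
    x + 0#           ≈⟨ +-identityʳ x ⟩
    x                ∎

  +-cancelʳ-≤ : ∀ z {x y} → x + z ≤ y + z → x ≤ y
  +-cancelʳ-≤ z {x} {y} x+z≤y+z = begin
    x            ≈⟨ [x+y]-y≈x x z ⟨
    (x + z) - z  ≤⟨ +-monoˡ-≤ (- z) x+z≤y+z ⟩
    (y + z) - z  ≈⟨ [x+y]-y≈x y z ⟩
    y            ∎

  x-y≤z⇒x≤z+y : ∀ {x y z} → x - y ≤ z → x ≤ z + y
  x-y≤z⇒x≤z+y {x} {y} {z} x-y≤z = begin
    x            ≈⟨ [x-y]+y≈x x y ⟨
    (x - y) + y  ≤⟨ +-monoˡ-≤ y x-y≤z ⟩
    z + y        ∎

  x≤y-z⇒x+z≤y : ∀ {x y z} → x ≤ y - z → x + z ≤ y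
  x≤y-z⇒x+z≤y {x} {y} {z} x≤y-z = begin
    x + z        ≤⟨ +-monoˡ-≤ z x≤y-z ⟩
    (y - z) + z  ≈⟨ [x-y]+y≈x y z ⟩
    y            ∎

  x≤y+x : ∀ {y} x → 0# ≤ y → x ≤ y + x
  x≤y+x {y} x 0≤y = begin
    x       ≈⟨ +-identityˡ x ⟨
    0# + x  ≤⟨ +-monoˡ-≤ x 0≤y ⟩
    y + x   ∎

  x≤x+y : ∀ {y} x → 0# ≤ y → x ≤ x + y
  x≤x+y {y} x 0≤y = ≤-trans (x≤y+x x 0≤y) (≤-reflexive (+-comm y x))

  +-nonNegative : ∀ {x y} → 0# ≤ x → 0# ≤ y → 0# ≤ x + y
  +-nonNegative {x} 0≤x 0≤y = ≤-trans 0≤x (x≤x+y x 0≤y)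

  neg-nonNegative : ∀ {x} → x ≤ 0# → 0# ≤ - x
  neg-nonNegative {x} x≤0 = begin
    0#        ≈⟨ -‿inverseʳ x ⟨
    x - x     ≤⟨ +-monoˡ-≤ (- x) x≤0 ⟩
    0# - x    ≈⟨ +-identityˡ (- x) ⟩
    - x       ∎

  *-monoʳ-≤ : ∀ {z x y} → 0# ≤ z → x ≤ y → z * x ≤ z * y
  *-monoʳ-≤ {z} {x} {y} 0≤z x≤y = begin
    z * x                ≤⟨ x≤y+x (z * x) (*-nonNegative 0≤z 0≤y-x) ⟩
    z * (y - x) + z * x  ≈⟨ distribˡ z (y - x) x ⟨
    z * ((y - x) + x)    ≈⟨ *-congˡ ([x-y]+y≈x y x) ⟩
    z * y                ∎
    where
    0≤y-x : 0# ≤ y - x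
    0≤y-x = begin
      0#     ≈⟨ -‿inverseʳ x ⟨
      x - x  ≤⟨ +-monoˡ-≤ (- x) x≤y ⟩
      y - x  ∎

  -- In the case `1# ≤ 0#` the element `- 1#` is nonnegative, and its square is `1#`.
  0≤1 : 0# ≤ 1#
  0≤1 with total 0# 1#
  ... | inj₁ 0≤1 = 0≤1
  ... | inj₂ 1≤0 = begin
    0#                ≤⟨ *-nonNegative 0≤-1 0≤-1 ⟩
    (- 1#) * (- 1#)   ≈⟨ -‿distribʳ-* (- 1#) 1# ⟨
    - ((- 1#) * 1#)   ≈⟨ -‿cong (*-identityʳ (- 1#)) ⟩
    - (- 1#)          ≈⟨ -‿involutive 1# ⟩
    1#                ∎
    where 0≤-1 = neg-nonNegative 1≤0

  1≰0 : ¬ (1# ≤ 0#)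
  1≰0 1≤0 = 0≉1 (≤-antisym 0≤1 1≤0)

  1≤x⇒x≉0 : ∀ {x} → 1# ≤ x → ¬ (x ≈ 0#)
  1≤x⇒x≉0 1≤x x≈0 = 1≰0 (≤-trans 1≤x (≤-reflexive x≈0))

  -- A nonpositive inverse would make `x * - x ⁻¹` nonnegative; adding it to `x * x ⁻¹ ≈ 1#` gives
  -- zero, hence `1# ≤ 0#`.
  ⁻¹-nonNegative : ∀ {x} → 1# ≤ x → 0# ≤ x ⁻¹
  ⁻¹-nonNegative {x} 1≤x with total 0# (x ⁻¹)
  ... | inj₁ 0≤x⁻¹ = 0≤x⁻¹
  ... | inj₂ x⁻¹≤0 = contradiction 1≤0 1≰0
    where
    1≤0 : 1# ≤ 0#
    1≤0 = begin
      1#                     ≈⟨ ⁻¹-inverseʳ x (1≤x⇒x≉0 1≤x) ⟨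
      x * x ⁻¹               ≤⟨ x≤y+x _ (*-nonNegative (≤-trans 0≤1 1≤x) (neg-nonNegative x⁻¹≤0)) ⟩
      x * - x ⁻¹ + x * x ⁻¹  ≈⟨ +-congʳ (-‿distribʳ-* x (x ⁻¹)) ⟨
      - (x * x ⁻¹) + x * x ⁻¹ ≈⟨ -‿inverseˡ (x * x ⁻¹) ⟩
      0#                     ∎

  0≤2 : 0# ≤ 2#
  0≤2 = +-nonNegative 0≤1 0≤1

  1≤2 : 1# ≤ 2#
  1≤2 = x≤y+x 1# 0≤1

  1≤3 : 1# ≤ 3#
  1≤3 = x≤y+x 1# 0≤2

  x/1≈x : ∀ x → x / 1# ≈ x
  x/1≈x x = begin-equality
    x * 1# ⁻¹         ≈⟨ *-congˡ (*-identityˡ (1# ⁻¹)) ⟨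
    x * (1# * 1# ⁻¹)  ≈⟨ *-congˡ (⁻¹-inverseʳ 1# (0≉1 ∘ Eq.sym)) ⟩
    x * 1#            ≈⟨ *-identityʳ x ⟩
    x                 ∎

  -- Maximisation over the subsets of a finite set.

  module _ {p : Level} where

    private
      HasMaximum : (P : Subset n → Set p) → (Subset n → Carrier) → Set (p ⊔ ℓ₂)
      HasMaximum P f = ∃ λ W → P W × (∀ V → P V → f V ≤ f W)

    -- Exhaustive search: the best subset containing the first element and the best one avoiding it
    -- are found recursively and compared. The negative outcome is needed for the recursion, since
    -- either half may have no subset satisfying `P`.
    maximum? : (P : Subset n → Set p) → Decidable P → (f : Subset n → Carrier) →
               HasMaximum P f ⊎ (∀ V → ¬ P V)
    maximum? {ℕ.zero} P P? f with P? []
    ... | yes P[] = inj₁ ([] , P[] , λ { [] _ → ≤-refl })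
    ... | no ¬P[] = inj₂ λ { [] → ¬P[] }
    maximum? {ℕ.suc n} P P? f
      with maximum? (P ∘ (inside ∷_)) (P? ∘ (inside ∷_)) (f ∘ (inside ∷_))
         | maximum? (P ∘ (outside ∷_)) (P? ∘ (outside ∷_)) (f ∘ (outside ∷_))
    ... | inj₂ ¬Pᵢ | inj₂ ¬Pₒ =
      inj₂ λ { (inside ∷ V) → ¬Pᵢ V ; (outside ∷ V) → ¬Pₒ V }
    ... | inj₂ ¬Pᵢ | inj₁ (Wₒ , PWₒ , maxₒ) = inj₁ (outside ∷ Wₒ , PWₒ ,
      λ { (inside ∷ V) PV → contradiction PV (¬Pᵢ V) ; (outside ∷ V) → maxₒ V })
    ... | inj₁ (Wᵢ , PWᵢ , maxᵢ) | inj₂ ¬Pₒ = inj₁ (inside ∷ Wᵢ , PWᵢ ,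
      λ { (inside ∷ V) → maxᵢ V ; (outside ∷ V) PV → contradiction PV (¬Pₒ V) })
    ... | inj₁ (Wᵢ , PWᵢ , maxᵢ) | inj₁ (Wₒ , PWₒ , maxₒ)
      with total (f (inside ∷ Wᵢ)) (f (outside ∷ Wₒ))
    ... | inj₁ i≤o = inj₁ (outside ∷ Wₒ , PWₒ ,
      λ { (inside ∷ V) PV → ≤-trans (maxᵢ V PV) i≤o ; (outside ∷ V) → maxₒ V })
    ... | inj₂ o≤i = inj₁ (inside ∷ Wᵢ , PWᵢ ,
      λ { (inside ∷ V) → maxᵢ V ; (outside ∷ V) PV → ≤-trans (maxₒ V PV) o≤i })

module BinStretchingProperties {c ℓ₁ ℓ₂} (F : OrderedField c ℓ₁ ℓ₂) where
  open OrderedField F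
  open OrderedFieldProperties F renaming (total to ≤-total)
  open BinStretching F

  -- Total sizes, and how they split between the machines.

  other : Machine → Machine
  other m₁ = m₂
  other m₂ = m₁

  total-tail : ∀ (j : Job) (js : Jobs n) s S → total js S ≤ total (j ∷ js) (s ∷ S)
  total-tail j js inside  S = x≤y+x (total js S) (proj₁ (size-pos j))
  total-tail j js outside S = ≤-refl

  total-mono : ∀ (js : Jobs n) {S T} → S ⊆ T → total js S ≤ total js T
  total-mono []       {[]}          {[]}          S⊆T = ≤-refl
  total-mono (j ∷ js) {outside ∷ S} {t ∷ T}       S⊆T =
    ≤-trans (total-mono js (drop-∷-⊆ S⊆T)) (total-tail j js t T)
  total-mono (j ∷ js) {inside ∷ S}  {inside ∷ T}  S⊆T =
    +-monoʳ-≤ (size j) (total-mono js (drop-∷-⊆ S⊆T))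
  total-mono (j ∷ js) {inside ∷ S}  {outside ∷ T} S⊆T with () ← S⊆T here

  total-⊥ : ∀ (js : Jobs n) → total js ⊥ ≡ 0#
  total-⊥ []       = refl
  total-⊥ (j ∷ js) = total-⊥ js

  total-split₁₂ : ∀ (js : Jobs n) S σ →
    total js (S ∩ jobsOn m₁ σ) + total js (S ∩ jobsOn m₂ σ) ≈ total js S
  total-split₁₂ []       []            []       = +-identityˡ 0#
  total-split₁₂ (j ∷ js) (outside ∷ S) (k ∷ σ)  = total-split₁₂ js S σ
  total-split₁₂ (j ∷ js) (inside ∷ S)  (m₁ ∷ σ) =
    Eq.trans (+-assoc _ _ _) (+-congˡ (total-split₁₂ js S σ))
  total-split₁₂ (j ∷ js) (inside ∷ S)  (m₂ ∷ σ) =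
    Eq.trans (solve 3 (λ a p b → a :+ (p :+ b) := p :+ (a :+ b)) Eq.refl _ (size j) _)
             (+-congˡ (total-split₁₂ js S σ))

  total-split : ∀ k (js : Jobs n) S σ →
    total js (S ∩ jobsOn k σ) + total js (S ∩ jobsOn (other k) σ) ≈ total js S
  total-split m₁ js S σ = total-split₁₂ js S σ
  total-split m₂ js S σ = Eq.trans (+-comm _ _) (total-split₁₂ js S σ)

  -- The right-hand side does not mention `σ`, so the load sums of the online and the offline
  -- schedule can be exchanged.
  load-sum : ∀ (js : Jobs n) σ → load m₁ js σ + load m₂ js σ ≈ total js ⊤
  load-sum js σ = ≡.subst₂ (λ S T → total js S + total js T ≈ total js ⊤)
    (∩-identityˡ (jobsOn m₁ σ)) (∩-identityˡ (jobsOn m₂ σ)) (total-split m₁ js ⊤ σ)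

  jobsOn₂-exactlyOn₂ : ∀ (W : Subset n) → jobsOn m₂ (exactlyOn₂ W) ≡ W
  jobsOn₂-exactlyOn₂ []            = refl
  jobsOn₂-exactlyOn₂ (inside ∷ W)  = cong (inside ∷_) (jobsOn₂-exactlyOn₂ W)
  jobsOn₂-exactlyOn₂ (outside ∷ W) = cong (outside ∷_) (jobsOn₂-exactlyOn₂ W)

  -- Sets of GoS-2 jobs and admissible schedules.

  lookup-gos₂Jobs : ∀ (js : Jobs n) i → lookup (gos₂Jobs js) i ≡ does (gos (lookup js i) ≟ᴳ gos₂)
  lookup-gos₂Jobs js i = lookup-map i _ js

  ⊆gos₂Jobs : ∀ (js : Jobs n) {S} →
    (∀ i → gos (lookup js i) ≡ gos₁ → lookup S i ≡ outside) → S ⊆ gos₂Jobs js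
  ⊆gos₂Jobs js avoids {i} i∈S with gos (lookup js i) in gᵢ
  ... | gos₁ with () ← ≡.trans (≡.sym ([]=⇒lookup i∈S)) (avoids i gᵢ)
  ... | gos₂ = lookup⇒[]= i _
    (≡.trans (lookup-gos₂Jobs js i) (cong (λ g → does (g ≟ᴳ gos₂)) gᵢ))

  ⊆gos₂Jobs⇒outside : ∀ (js : Jobs n) {S} → S ⊆ gos₂Jobs js →
    ∀ i → gos (lookup js i) ≡ gos₁ → lookup S i ≡ outside
  ⊆gos₂Jobs⇒outside js {S} S⊆ i gᵢ with lookup S i in sᵢ
  ... | outside = refl
  ... | inside  = ≡.trans (≡.sym ([]=⇒lookup (S⊆ (lookup⇒[]= i S sᵢ))))
    (≡.trans (lookup-gos₂Jobs js i) (cong (λ g → does (g ≟ᴳ gos₂)) gᵢ))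

  jobsOn₂⊆gos₂Jobs : ∀ (js : Jobs n) {σ} → Admissible js σ → jobsOn m₂ σ ⊆ gos₂Jobs js
  jobsOn₂⊆gos₂Jobs js {σ} adm = ⊆gos₂Jobs js λ i gᵢ →
    ≡.trans (lookup-map i _ σ) (cong (λ k → does (k ≟ᴹ m₂)) (adm i gᵢ))

  -- A GoS-1 job is on `m₁` both before and after the arrival, so it never changes machine.
  migrated⊆gos₂Jobs : ∀ (j : Job) (js : Jobs n) σ τ →
    Admissible js σ → Admissible (j ∷ js) τ → migrated σ τ ⊆ gos₂Jobs js
  migrated⊆gos₂Jobs j js σ (_ ∷ τ) σ-adm τ-adm = ⊆gos₂Jobs js λ i gᵢ →
    ≡.trans (lookup-zipWith _ i σ τ)
      (cong₂ (λ k k′ → not (does (k ≟ᴹ k′))) (σ-adm i gᵢ) (τ-adm (suc i) gᵢ))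

  total-unmigrated : ∀ (js : Jobs n) σ k → total js (migrated σ (k ∷ σ)) ≡ 0#
  total-unmigrated []       []       k = refl
  total-unmigrated (j ∷ js) (m₁ ∷ σ) k = total-unmigrated js σ k
  total-unmigrated (j ∷ js) (m₂ ∷ σ) k = total-unmigrated js σ k

  -- The search cannot fail, because the empty set qualifies.
  maximumSubset : ∀ (js : Jobs n) → ∃ (IsMaximumSubset js)
  maximumSubset js
    with maximum? (λ W → W ⊆ gos₂Jobs js × total js W ≤ 1#)
           (λ W → (W ⊆? gos₂Jobs js) ×-dec (total js W ≤? 1#)) (total js)
  ... | inj₁ (W , (W⊆ , W≤1) , max) = W , W⊆ , W≤1 , λ V V⊆ V≤1 → max V (V⊆ , V≤1)
  ... | inj₂ none = ⊥-elim
    (none ⊥ (⊆-min (gos₂Jobs js) , ≡.subst (_≤ 1#) (≡.sym (total-⊥ js)) 0≤1))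

  -- Comparison with an offline schedule.

  Fits : Jobs n → Schedule n → Set ℓ₂
  Fits js σ = ∀ k → load k js σ ≤ 1#

  optimal⇒fits : ∀ (js : Jobs n) σ → makespan js σ ≈ 1# → Fits js σ
  optimal⇒fits js _ ≈1 m₁ = ≤-trans (x≤x⊔y _ _) (≤-reflexive ≈1)
  optimal⇒fits js _ ≈1 m₂ = ≤-trans (x≤y⊔x _ _) (≤-reflexive ≈1)

  -- Only the complete input has optimum 1; a prefix may have a smaller one. What survives dropping
  -- the later jobs is the upper bound on both loads, since sizes are positive.
  fits-prefix : ∀ {m} (later : Jobs m) (js : Jobs n) σ → Fits (later ++ js) σ → ∃ (Fits js)
  fits-prefix []          js σ        fits = σ , fits
  fits-prefix (j ∷ later) js (k′ ∷ σ) fits = fits-prefix later js σ λ k →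
    ≤-trans (total-tail j (later ++ js) (does (k′ ≟ᴹ k)) (jobsOn k σ)) (fits k)

  -- This is the maximality clause of `IsMaximumSubset` with the value `y` left free, so a maximum
  -- `W` satisfies it directly with `y` its total.
  Dominates : Carrier → Jobs n → Set ℓ₂
  Dominates y js = ∀ V → V ⊆ gos₂Jobs js → total js V ≤ 1# → total js V ≤ y

  -- The earlier GoS-2 jobs are split by `τ`. Those sharing the machine of `j` total at most 1
  -- together with `j`; those on the other machine form a GoS-2 set of total at most 1, which `y`
  -- dominates.
  gos₂-bound : ∀ {y} (j : Job) (js : Jobs n) τ → Dominates y js → Fits (j ∷ js) τ →
    total js (gos₂Jobs js) + size j ≤ 1# + y
  gos₂-bound {y = y} j js (k ∷ τ) dom fits = bound k (own k fits) (others k fits)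
    where
    G = gos₂Jobs js

    -- Once `k` is a concrete machine, the load with `j` in front computes, to include `size j` here
    -- and to omit it in `others`.
    own : ∀ k → Fits (j ∷ js) (k ∷ τ) → size j + load k js τ ≤ 1#
    own m₁ fits = fits m₁
    own m₂ fits = fits m₂

    others : ∀ k → Fits (j ∷ js) (k ∷ τ) → load (other k) js τ ≤ 1#
    others m₁ fits = fits m₂
    others m₂ fits = fits m₁

    bound : ∀ k → size j + load k js τ ≤ 1# → load (other k) js τ ≤ 1# → total js G + size j ≤ 1# + y
    bound k own≤1 other≤1 = begin
      total js G + size j
        ≈⟨ +-congʳ (total-split k js G τ) ⟨
      (total js (G ∩ jobsOn k τ) + total js (G ∩ jobsOn (other k) τ)) + size j
        ≈⟨ solve 3 (λ a b p → (a :+ b) :+ p := (p :+ a) :+ b) Eq.refl _ _ (size j) ⟩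
      (size j + total js (G ∩ jobsOn k τ)) + total js (G ∩ jobsOn (other k) τ)
        ≤⟨ +-mono-≤ (≤-trans (+-monoʳ-≤ (size j) (total-mono js (p∩q⊆q G _))) own≤1)
             (dom _ (p∩q⊆p G _) (≤-trans (total-mono js (p∩q⊆q G _)) other≤1)) ⟩
      1# + y ∎

  -- Algorithm A: the constant `μ` and its arithmetic.

  module AlgorithmAProperties (M : Carrier) (5/2≤M : 5# / 2# ≤ M) where
    open AlgorithmA M

    private
      D : Carrier
      D = 2# * M + 3#

    0≤M : 0# ≤ M
    0≤M = ≤-trans (*-nonNegative (+-nonNegative (≤-trans 0≤1 1≤3) 0≤2) (⁻¹-nonNegative 1≤2)) 5/2≤M

    1≤D : 1# ≤ D
    1≤D = ≤-trans 1≤3 (x≤y+x 3# (*-nonNegative 0≤2 0≤M))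

    D*D⁻¹≈1 : D * D ⁻¹ ≈ 1#
    D*D⁻¹≈1 = ⁻¹-inverseʳ D (1≤x⇒x≉0 1≤D)

    0≤μ : 0# ≤ μ
    0≤μ = *-nonNegative 0≤2 (⁻¹-nonNegative 1≤D)

    1≤1+μ : 1# ≤ 1# + μ
    1≤1+μ = x≤x+y 1# 0≤μ

    D*μ≈2 : D * μ ≈ 2#
    D*μ≈2 = begin-equality
      D * (2# * D ⁻¹)  ≈⟨ solve 2 (λ d i → d :* (con 2 :* i) := con 2 :* (d :* i)) Eq.refl D (D ⁻¹) ⟩
      2# * (D * D ⁻¹)  ≈⟨ *-congˡ D*D⁻¹≈1 ⟩
      2# * 1#          ≈⟨ *-identityʳ 2# ⟩
      2#               ∎

    1+μ≈ratio : 1# + μ ≈ (2# * M + 5#) / (2# * M + 3#)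
    1+μ≈ratio = begin-equality
      1# + 2# * D ⁻¹              ≈⟨ +-congʳ D*D⁻¹≈1 ⟨
      D * D ⁻¹ + 2# * D ⁻¹        ≈⟨ distribʳ (D ⁻¹) D 2# ⟨
      (D + 2#) * D ⁻¹             ≈⟨ *-congʳ (+-assoc (2# * M) 3# 2#) ⟩
      (2# * M + 5#) * D ⁻¹        ∎

    -- Here `t` is the total of the earlier GoS-2 jobs, `y` the load of `m₂` and `p` the size of the
    -- new job. The value of `μ` is the one for which `2#` equals `M * (2# * μ) + 3# * μ`.
    migration-arithmetic : ∀ {t y p} → y ≤ 1# - μ → 1# + μ ≤ y + p → t + p ≤ 1# + y → t ≤ M * p
    migration-arithmetic {t} {y} {p} y≤1-μ 1+μ≤y+p t+p≤1+y = ≤-trans t≤M*2μ (*-monoʳ-≤ 0≤M 2μ≤p)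
      where
      y+μ≤1 : y + μ ≤ 1#
      y+μ≤1 = x≤y-z⇒x+z≤y y≤1-μ

      -- The semiring solver knows no subtraction, so a common summand is added to both sides and
      -- cancelled, here and below.
      2μ≤p : 2# * μ ≤ p
      2μ≤p = +-cancelʳ-≤ (1# + y) (begin
        2# * μ + (1# + y)     ≈⟨ solve 2 (λ m z → con 2 :* m :+ (con 1 :+ z) := (con 1 :+ m) :+ (z :+ m)) Eq.refl μ y ⟩
        (1# + μ) + (y + μ)    ≤⟨ +-mono-≤ 1+μ≤y+p y+μ≤1 ⟩
        (y + p) + 1#          ≈⟨ solve 2 (λ z q → (z :+ q) :+ con 1 := q :+ (con 1 :+ z)) Eq.refl y p ⟩
        p + (1# + y)          ∎)

      t≤M*2μ : t ≤ M * (2# * μ)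
      -- Of the three copies of `μ`, two are absorbed by `p` and the third by the gap between `y`
      -- and 1.
      t≤M*2μ = +-cancelʳ-≤ (3# * μ) (begin
        t + 3# * μ                ≈⟨ solve 2 (λ a m → a :+ con 3 :* m := (a :+ con 2 :* m) :+ m) Eq.refl t μ ⟩
        (t + 2# * μ) + μ          ≤⟨ +-monoˡ-≤ μ (≤-trans (+-monoʳ-≤ t 2μ≤p) t+p≤1+y) ⟩
        (1# + y) + μ              ≈⟨ +-assoc 1# y μ ⟩
        1# + (y + μ)              ≤⟨ +-monoʳ-≤ 1# y+μ≤1 ⟩
        2#                        ≈⟨ D*μ≈2 ⟨
        D * μ                     ≈⟨ solve 2 (λ a m → (con 2 :* a :+ con 3) :* m := a :* (con 2 :* m) :+ con 3 :* m) Eq.refl M μ ⟩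
        M * (2# * μ) + 3# * μ     ∎)

    -- Existence of a run, and induction over arrivals.

    step : ∀ (j : Job) (js : Jobs n) σ → ∃ (Step j js σ)
    step j js σ with gos j in g | 1# - μ ≤? load m₂ js σ | load m₂ js σ + size j ≤? 1# + μ
    ... | gos₁ | _      | _        = _ , rule-i (inj₁ g)
    ... | gos₂ | yes big | _        = _ , rule-i (inj₂ big)
    ... | gos₂ | no ¬big | yes fits = _ , rule-ii g (≰⇒> ¬big) fits
    ... | gos₂ | no ¬big | no ¬fits =
      let W , W-max = maximumSubset (j ∷ js) in _ , rule-iii g (≰⇒> ¬big) (≰⇒> ¬fits) W W-max

    run : SemiOnlineAlgorithm
    run []       = []
    run (j ∷ js) = proj₁ (step j js (run js))

    -- Ensures that the results about every algorithm satisfying `IsAlgorithmA` are not vacuous.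
    run-isAlgorithmA : IsAlgorithmA run
    run-isAlgorithmA j js = proj₂ (step j js (run js))

    invariant : ∀ {p} (P : ∀ {n} → Jobs n → Schedule n → Set p) → P [] [] →
      (∀ {n} {j : Job} {js : Jobs n} {σ τ} → Step j js σ τ → P js σ → P (j ∷ js) τ) →
      ∀ (alg : SemiOnlineAlgorithm) → IsAlgorithmA alg → ∀ {n} (js : Jobs n) → P js (alg js)
    -- For an arbitrary `alg` the term `alg []` does not reduce to `[]`; matching identifies them.
    invariant P P[] preserved alg isA [] with alg []
    ... | [] = P[]
    invariant P P[] preserved alg isA (j ∷ js) =
      preserved (isA j js) (invariant P P[] preserved alg isA js)

    -- Invariants of a run: admissibility, load of `m₂`, dominance.

    step-admissible : ∀ {j : Job} {js : Jobs n} {σ τ} →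
      Step j js σ τ → Admissible js σ → Admissible (j ∷ js) τ
    step-admissible (rule-i _)      adm zero    _  = refl
    step-admissible (rule-i _)      adm (suc i) gᵢ = adm i gᵢ
    step-admissible (rule-ii g _ _) adm zero    g₁ with () ← ≡.trans (≡.sym g) g₁
    step-admissible (rule-ii g _ _) adm (suc i) gᵢ = adm i gᵢ
    step-admissible {j = j} {js} (rule-iii _ _ _ W (W⊆ , _)) adm i gᵢ =
      ≡.trans (lookup-map i _ W)
        (cong (λ b → if b then m₂ else m₁) (⊆gos₂Jobs⇒outside (j ∷ js) W⊆ i gᵢ))

    admissible : ∀ (alg : SemiOnlineAlgorithm) → IsAlgorithmA alg → RespectsGoS alg
    admissible = invariant Admissible (λ ()) step-admissible

    step-load₂ : ∀ {j : Job} {js : Jobs n} {σ τ} →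
      Step j js σ τ → load m₂ js σ ≤ 1# + μ → load m₂ (j ∷ js) τ ≤ 1# + μ
    step-load₂ (rule-i _) y≤1+μ = y≤1+μ
    step-load₂ (rule-ii _ _ y+p≤1+μ) _ = ≤-trans (≤-reflexive (+-comm _ _)) y+p≤1+μ
    step-load₂ {j = j} {js} (rule-iii _ _ _ W (_ , W≤1 , _)) _ =
      ≡.subst (λ S → total (j ∷ js) S ≤ 1# + μ) (≡.sym (jobsOn₂-exactlyOn₂ W)) (≤-trans W≤1 1≤1+μ)

    load₂≤1+μ : ∀ (alg : SemiOnlineAlgorithm) → IsAlgorithmA alg → ∀ {n} (js : Jobs n) → load m₂ js (alg js) ≤ 1# + μ
    load₂≤1+μ = invariant (λ js σ → load m₂ js σ ≤ 1# + μ) (≤-trans 0≤1 1≤1+μ) step-load₂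

    -- The guard is essential: at load `1# - μ` or more, rule (i) puts even GoS-2 jobs on `m₁`, and
    -- dominance can be lost.
    DominatesIfSmall : Jobs n → Schedule n → Set (ℓ₁ ⊔ ℓ₂)
    DominatesIfSmall js σ = load m₂ js σ < 1# - μ → Dominates (load m₂ js σ) js

    -- Rule (i) leaves the load unchanged, so a small load was small before, and then `j` has GoS 1
    -- and lies in no competing set `V`. Under rule (ii) the load grows by `size j`, while `V` gains
    -- at most that. Under rule (iii) dominance is the maximality of `W`.
    step-dominates : ∀ {j : Job} {js : Jobs n} {σ τ} →
      Step j js σ τ → DominatesIfSmall js σ → DominatesIfSmall (j ∷ js) τ
    step-dominates (rule-i _) dom small (outside ∷ V) V⊆ V≤1 = dom small V (drop-∷-⊆ V⊆) V≤1
    step-dominates (rule-i (inj₂ big)) dom small (inside ∷ V) V⊆ V≤1 = contradiction big (<⇒≱ small)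
    step-dominates {j = j} {js} (rule-i (inj₁ g)) dom small (inside ∷ V) V⊆ V≤1
      with () ← ⊆gos₂Jobs⇒outside (j ∷ js) V⊆ zero g
    step-dominates {j = j} {js} (rule-ii _ small _) dom _ (outside ∷ V) V⊆ V≤1 =
      ≤-trans (dom small V (drop-∷-⊆ V⊆) V≤1) (total-tail j js inside _)
    step-dominates {j = j} {js} (rule-ii _ small _) dom _ (inside ∷ V) V⊆ V≤1 =
      +-monoʳ-≤ (size j) (dom small V (drop-∷-⊆ V⊆) (≤-trans (total-tail j js inside V) V≤1))
    step-dominates {j = j} {js} (rule-iii _ _ _ W (_ , _ , W-max)) _ _ =
      ≡.subst (λ S → Dominates (total (j ∷ js) S) (j ∷ js)) (≡.sym (jobsOn₂-exactlyOn₂ W)) W-max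

    dominates : ∀ (alg : SemiOnlineAlgorithm) → IsAlgorithmA alg → ∀ {n} (js : Jobs n) → DominatesIfSmall js (alg js)
    dominates = invariant DominatesIfSmall (λ { _ [] _ _ → ≤-refl }) step-dominates

    -- The migration bound.

    step-migration : ∀ {j : Job} {js : Jobs n} {σ τ} ρ → Step j js σ τ →
      Admissible js σ → DominatesIfSmall js σ → Fits (j ∷ js) ρ →
      total js (migrated σ τ) ≤ M * size j
    -- Whatever `W` is, the migrated jobs are bounded by all earlier GoS-2 jobs together. The other
    -- two rules move nothing.
    step-migration {j = j} {js} {σ} ρ s@(rule-iii _ small big W _) adm dom fits = ≤-trans
      (total-mono js (migrated⊆gos₂Jobs j js σ (exactlyOn₂ W) adm (step-admissible s adm)))
      (migration-arithmetic (proj₁ small) (proj₁ big) (gos₂-bound j js ρ (dom small) fits))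
    step-migration {j = j} {js} {σ} _ (rule-i _) _ _ _ =
      ≡.subst (_≤ M * size j) (≡.sym (total-unmigrated js σ m₁)) (*-nonNegative 0≤M (proj₁ (size-pos j)))
    step-migration {j = j} {js} {σ} _ (rule-ii _ _ _) _ _ _ =
      ≡.subst (_≤ M * size j) (≡.sym (total-unmigrated js σ m₂)) (*-nonNegative 0≤M (proj₁ (size-pos j)))

    migration-bound : ∀ (alg : SemiOnlineAlgorithm) → IsAlgorithmA alg → MigrationFactorAtMost M alg
    migration-bound alg isA later j js ((σ , _ , ≈1) , _) =
      let ρ , fits = fits-prefix later (j ∷ js) σ (optimal⇒fits (later ++ j ∷ js) σ ≈1) in
      step-migration ρ (isA j js) (admissible alg isA js) (dominates alg isA js) fits

    -- The makespan bound and the competitive ratio.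

    load₁≤1+μ : ∀ (js : Jobs n) σ ρ → DominatesIfSmall js σ → Admissible js ρ → Fits js ρ →
      load m₁ js σ ≤ 1# + μ
    load₁≤1+μ js σ ρ dom adm fits with 1# - μ ≤? load m₂ js σ
    -- The total size is at most 2 by `ρ`, and `m₂` already takes at least `1# - μ` of it.
    ... | yes big = +-cancelʳ-≤ 1# (begin
      load m₁ js σ + 1#                     ≤⟨ +-monoʳ-≤ _ (x-y≤z⇒x≤z+y big) ⟩
      load m₁ js σ + (load m₂ js σ + μ)     ≈⟨ +-assoc _ _ μ ⟨
      (load m₁ js σ + load m₂ js σ) + μ     ≈⟨ +-congʳ (Eq.trans (load-sum js σ) (Eq.sym (load-sum js ρ))) ⟩
      (load m₁ js ρ + load m₂ js ρ) + μ     ≤⟨ +-monoˡ-≤ μ (+-mono-≤ (fits m₁) (fits m₂)) ⟩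
      (1# + 1#) + μ                         ≈⟨ solve 1 (λ m → (con 1 :+ con 1) :+ m := (con 1 :+ m) :+ con 1) Eq.refl μ ⟩
      (1# + μ) + 1#                         ∎)
    -- The jobs that `ρ` puts on `m₂` are a GoS-2 set of total at most 1, hence dominated by the
    -- online load of `m₂`; this even gives load at most 1 on `m₁`.
    ... | no ¬big = ≤-trans (+-cancelʳ-≤ (load m₂ js σ) (begin
      load m₁ js σ + load m₂ js σ  ≈⟨ Eq.trans (load-sum js σ) (Eq.sym (load-sum js ρ)) ⟩
      load m₁ js ρ + load m₂ js ρ  ≤⟨ +-mono-≤ (fits m₁) (dom (≰⇒> ¬big) _ (jobsOn₂⊆gos₂Jobs js adm) (fits m₂)) ⟩
      1# + load m₂ js σ            ∎)) 1≤1+μ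

    makespan-bound : ∀ (alg : SemiOnlineAlgorithm) → IsAlgorithmA alg → ∀ {n} (js : Jobs n) → IsOptimalMakespan js 1# →
      makespan js (alg js) ≤ 1# + μ
    makespan-bound alg isA js ((ρ , adm , ≈1) , _) =
      ⊔-lub (load₁≤1+μ js (alg js) ρ (dominates alg isA js) adm (optimal⇒fits js ρ ≈1)) (load₂≤1+μ alg isA js)

    -- A supremum is below every upper bound, so bounding each single ratio suffices.
    ratio-bound : ∀ (alg : SemiOnlineAlgorithm) → IsAlgorithmA alg →
      ∀ r → IsCompetitiveRatio alg r → r ≤ (2# * M + 5#) / (2# * M + 3#)
    ratio-bound alg isA r (_ , least) = least _ λ { x (_ , js , opt , x≈) → begin
      x                              ≈⟨ x≈ ⟩
      makespan js (alg js) / 1#      ≈⟨ x/1≈x _ ⟩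
      makespan js (alg js)           ≤⟨ makespan-bound alg isA js opt ⟩
      1# + μ                         ≈⟨ 1+μ≈ratio ⟩
      (2# * M + 5#) / (2# * M + 3#)  ∎ }

mainTheorem1 : ∀ {c ℓ₁ ℓ₂} (F : OrderedField c ℓ₁ ℓ₂) →
    let open OrderedField F
        open BinStretching F in
    (M : Carrier) → 5# / 2# ≤ M →
    let open AlgorithmA M in
    ∃ (λ (alg : SemiOnlineAlgorithm) → IsAlgorithmA alg) ×
    ((alg : SemiOnlineAlgorithm) → IsAlgorithmA alg →
      RespectsGoS alg ×
      MigrationFactorAtMost M alg ×
      (∀ {n} (js : Jobs n) → IsOptimalMakespan js 1# →
        makespan js (alg js) ≤ 1# + μ) ×
      1# + μ ≈ (2# * M + 5#) / (2# * M + 3#) ×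
      (∀ r → IsCompetitiveRatio alg r → r ≤ (2# * M + 5#) / (2# * M + 3#)))
mainTheorem1 F M 5/2≤M = (run , run-isAlgorithmA) , λ alg isA →
  admissible alg isA , migration-bound alg isA , makespan-bound alg isA ,
  1+μ≈ratio , ratio-bound alg isA
  where
  open BinStretchingProperties F
  open AlgorithmAProperties M 5/2≤M
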